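{- There exists a strongly connected oriented graph $D$ with maximum degree $\Delta(D)\le 5$ such that $\mathrm{fas}(D)> 2n/3$, where $n$ is the number of vertices of $D$. (That is, the conjecture that $\mathrm{fas}(D)\le 2n/3$ for every strongly connected oriented graph $D$ with $\Delta(D)\le 5$ is false.)
   Context: All digraphs are finite. An oriented graph is a directed graph without loops, without parallel arcs and without directed cycles of length 2. The degree of a vertex is the sum of its out-degree and in-degree, and $\Delta(D)$ is the maximum degree. $\mathrm{fas}(D)$ is the minimum number of arcs in a feedback arc set of $D$, i.e. in a set $F$ of arcs such that $D-F$ has no directed cycle. -}

module Defs where

open import Algebra.Properties.CommutativeMonoid.Sum using (sum)
open import Data.Fin using (Fin)
open import Data.Fin.Subset using (Subset; _∈_; _⊆_; _─_; ∣_∣)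
open import Data.List using (List; _∷_; _∷ʳ_)
open import Data.List.Relation.Unary.Linked using (Linked)
open import Data.List.Relation.Unary.Unique.Propositional using (Unique)
open import Data.Nat using (ℕ; _+_; _≤_; _⊔_)
open import Data.Nat.Properties using (+-0-commutativeMonoid)
open import Data.Product using (_×_; ∃-syntax)
open import Data.Vec using (lookup; tabulate)
open import Data.Vec.Functional using (foldr)
open import Relation.Binary.Construct.Closure.ReflexiveTransitive using (Star)
open import Relation.Binary.PropositionalEquality using (_≡_)
open import Relation.Nullary using (¬_)

-- A digraph on the vertex set Fin n, given by its out-neighbourhoods.
-- Parallel arcs are excluded by this encoding; loops and 2-cycles are not.
Digraph : ℕ → Set
Digraph n = Fin n → Subset n

module _ {n : ℕ} where

  Arc : Digraph n → Fin n → Fin n → Set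
  Arc D u v = v ∈ D u

  inNeighbours : Digraph n → Fin n → Subset n
  inNeighbours D v = tabulate (λ u → lookup (D u) v)

  size : Digraph n → ℕ
  size D = sum +-0-commutativeMonoid (λ u → ∣ D u ∣)

  record Oriented (D : Digraph n) : Set where
    field
      loopless  : ∀ v → ¬ Arc D v v
      no2Cycles : ∀ u v → Arc D u v → ¬ Arc D v u

  StronglyConnected : Digraph n → Set
  StronglyConnected D = ∀ u v → Star (Arc D) u v

  degree : Digraph n → Fin n → ℕ
  degree D v = ∣ D v ∣ + ∣ inNeighbours D v ∣

  Δ : Digraph n → ℕ
  Δ D = foldr _⊔_ 0 (degree D)

  -- The directed cycle visiting v and then vs in order, before returning to v.
  -- A loop is the case where vs is empty.
  record DirectedCycle (D : Digraph n) (v : Fin n) (vs : List (Fin n)) : Set where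
    field
      distinct : Unique (v ∷ vs)
      arcs     : Linked (Arc D) (v ∷ (vs ∷ʳ v))

  Acyclic : Digraph n → Set
  Acyclic D = ∀ v vs → ¬ DirectedCycle D v vs

  -- A set of arcs is encoded as the spanning subdigraph with those arcs.
  _-ᵃ_ : Digraph n → Digraph n → Digraph n
  (D -ᵃ F) u = D u ─ F u

  record FeedbackArcSet (D F : Digraph n) : Set where
    field
      subset  : ∀ u → F u ⊆ D u
      acyclic : Acyclic (D -ᵃ F)

  -- IsFas D k says fas(D) = k.  The minimum is given as a relation because a
  -- function would have to compute it by searching through all arc sets.
  record IsFas (D : Digraph n) (k : ℕ) : Set where
    field
      attained : ∃[ F ] (FeedbackArcSet D F × size F ≡ k)
      minimal  : ∀ F → FeedbackArcSet D F → k ≤ size F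

{-# OPTIONS --safe #-}

-- The digraph D arises from the rotational tournament u → u+1, u+3, u+5 on ℤ/7
-- by deleting the arcs 2 → 0, 3 → 1, 5 → 3 and 6 → 4.  In the natural order it
-- has 5 backward arcs.  It also has 9 triangles such that no arc is in more
-- than two of them.  A feedback arc set F contains an arc of each triangle, so
-- 9 ≤ 2 |F|, and hence fas(D) = 5 > 14/3.

module Submission where

open import Defs
open import Data.Bool using (Bool; true; false; if_then_else_)
open import Data.Fin using (Fin; zero; suc; inject₁; fromℕ) renaming (_<_ to _<ᶠ_)
open import Data.Fin.Induction using (<-weakInduction; >-weakInduction)
open import Data.Fin.Patterns
open import Data.Fin.Properties using (all?; _≟_)
  renaming (<-trans to <ᶠ-trans; <-irrefl to <ᶠ-irrefl; _<?_ to _<ᶠ?_)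
open import Data.Fin.Subset using (Subset; _∩_; ⁅_⁆; ⋃; ∣_∣)
open import Data.Fin.Subset.Properties using (_∈?_; p∩q⊆p; x∈p∧x∉q⇒x∈p─q)
open import Data.List using (List; []; _∷_; _∷ʳ_; map)
open import Data.List.Membership.DecPropositional using () renaming (_∈?_ to ∈-dec)
open import Data.List.Membership.Propositional using (_∈_; find)
open import Data.List.Relation.Unary.All using (All; []; _∷_)
open import Data.List.Relation.Unary.All.Properties using (∷ʳ⁻; ¬Any⇒All¬)
open import Data.List.Relation.Unary.AllPairs using (_∷_)
open import Data.List.Relation.Unary.Any using (any?)
open import Data.List.Relation.Unary.Linked as Linked using (Linked; []; [-]; _∷_; linked?)
open import Data.List.Relation.Unary.Linked.Properties using (Linked⇒AllPairs)
open import Data.List.Relation.Unary.Unique.DecPropositional using (unique?)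
open import Data.Nat using (ℕ; zero; suc; _*_; _≤_; _<_; z≤n; _≤?_; _<?_)
open import Data.Nat.Properties
  using (module ≤-Reasoning; +-*-semiring; ≤-reflexive; ≤-trans; +-mono-≤; *-monoʳ-≤;
         *-comm; *-cancelˡ-<; m≤m+n)
open import Data.Product using (_×_; _,_; proj₂; Σ-syntax; ∃-syntax; uncurry)
open import Data.Product.Properties using (≡-dec)
open import Data.Vec using ([]; _∷_; lookup; tabulate)
open import Data.Vec.Properties using ([]=⇒lookup)
open import Function using (_∘_)
open import Relation.Binary.Construct.Closure.ReflexiveTransitive using (Star; ε; _◅_; _◅◅_)
open import Relation.Binary.PropositionalEquality using (_≡_; refl; sym; cong; cong₂)
open import Relation.Nullary using (¬_; Dec; does; yes; no; ¬?; contradiction)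
open import Relation.Nullary.Decidable using (from-yes; map′; _×-dec_; _→-dec_; dec-true)

open import Algebra.Properties.Semiring.Sum +-*-semiring
  using (sum; sum-syntax; sum-cong-≗; sum-remove; ∑-comm; *-distribˡ-sum)

private
  variable
    m n : ℕ

sum-mono-≤ : {f g : Fin n → ℕ} → (∀ i → f i ≤ g i) → sum f ≤ sum g
sum-mono-≤ {zero}  f≤g = z≤n
sum-mono-≤ {suc n} f≤g = +-mono-≤ (f≤g zero) (sum-mono-≤ (f≤g ∘ suc))

fᵢ≤sum : (f : Fin n → ℕ) (i : Fin n) → f i ≤ sum f
fᵢ≤sum {suc n} f i = ≤-trans (m≤m+n _ _) (≤-reflexive (sym (sum-remove {i = i} f)))

n≤sum : {f : Fin n → ℕ} → (∀ i → 1 ≤ f i) → n ≤ sum f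
n≤sum {zero}  1≤f = z≤n
n≤sum {suc n} 1≤f = +-mono-≤ (1≤f zero) (n≤sum (1≤f ∘ suc))

𝟙 : Bool → ℕ
𝟙 b = if b then 1 else 0

∣p∣≡sum : (p : Subset n) → ∣ p ∣ ≡ ∑[ v < n ] 𝟙 (lookup p v)
∣p∣≡sum []          = refl
∣p∣≡sum (true  ∷ p) = cong suc (∣p∣≡sum p)
∣p∣≡sum (false ∷ p) = ∣p∣≡sum p

size≡sum : (D : Digraph n) → size D ≡ ∑[ u < n ] ∑[ v < n ] 𝟙 (lookup (D u) v)
size≡sum D = sum-cong-≗ (∣p∣≡sum ∘ D)

steps : {A : Set} → List A → List (A × A)
steps []           = []
steps (x ∷ [])     = []
steps (x ∷ y ∷ zs) = (x , y) ∷ steps (y ∷ zs)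

-- (v , vs) stands for the closed walk of DirectedCycle D v vs.
cycleArcs : Fin n × List (Fin n) → List (Fin n × Fin n)
cycleArcs (v , vs) = steps (v ∷ (vs ∷ʳ v))

infix 4 _∈ᵃ?_

_∈ᵃ?_ : (a : Fin n × Fin n) (as : List (Fin n × Fin n)) → Dec (a ∈ as)
_∈ᵃ?_ = ∈-dec (≡-dec _≟_ _≟_)

onCycle : Fin n × List (Fin n) → Fin n → Fin n → ℕ
onCycle c u v = 𝟙 (does ((u , v) ∈ᵃ? cycleArcs c))

module _ {D F : Digraph n} where

  avoid : ∀ {vs} → Linked (Arc D) vs → All (¬_ ∘ uncurry (Arc F)) (steps vs) →
          Linked (Arc (D -ᵃ F)) vs
  avoid []       _            = []
  avoid [-]      _            = [-]
  avoid (a ∷ as) (a∉F ∷ as∉F) = x∈p∧x∉q⇒x∈p─q a a∉F ∷ avoid as as∉F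

  -- If no arc of the cycle were in `F`, the whole cycle would survive in `D -ᵃ F`.
  hit : ∀ {v vs} → Acyclic (D -ᵃ F) → DirectedCycle D v vs →
        ∃[ a ] (a ∈ cycleArcs (v , vs) × uncurry (Arc F) a)
  hit {v} {vs} acyclic c with any? (λ (x , y) → y ∈? F x) (cycleArcs (v , vs))
  ... | yes some = find some
  ... | no  none = contradiction
    (record { distinct = distinct ; arcs = avoid arcs (¬Any⇒All¬ _ none) }) (acyclic v vs)
    where open DirectedCycle c

  -- The double sum counts the arcs that `F` shares with the cycle; the arc found by `hit` already
  -- contributes a term equal to 1.
  hit-count : ∀ {v vs} → Acyclic (D -ᵃ F) → DirectedCycle D v vs →
              1 ≤ ∑[ x < n ] ∑[ y < n ] (𝟙 (lookup (F x) y) * onCycle (v , vs) x y)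
  hit-count {v} {vs} acyclic c with hit acyclic c
  ... | (x , y) , on , xy∈F = begin
    1              ≡⟨ cong₂ (λ b b′ → 𝟙 b * 𝟙 b′) ([]=⇒lookup xy∈F) (dec-true (_ ∈ᵃ? _) on) ⟨
    t x y          ≤⟨ fᵢ≤sum (t x) y ⟩
    sum (t x)      ≤⟨ fᵢ≤sum (sum ∘ t) x ⟩
    sum (sum ∘ t)  ∎
    where
    open ≤-Reasoning
    t : Fin n → Fin n → ℕ
    t x y = 𝟙 (lookup (F x) y) * onCycle (v , vs) x y

  -- Double counting of the pairs of a cycle `C i` and an arc of `F` on it: every cycle is in at
  -- least one pair, every arc of `F` in at most `k`.
  packing-bound : (C : Fin m → Fin n × List (Fin n)) (k : ℕ) →
                  (∀ i → uncurry (DirectedCycle D) (C i)) →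
                  (∀ x y → ∑[ i < m ] onCycle (C i) x y ≤ k) →
                  Acyclic (D -ᵃ F) → m ≤ k * size F
  packing-bound {m} C k cycles load acyclic = begin
    m
      ≤⟨ n≤sum (λ i → hit-count acyclic (cycles i)) ⟩
    ∑[ i < m ] ∑[ x < n ] ∑[ y < n ] (f x y * w i x y)
      -- Two exchanges of summation bring the sum over the cycles innermost, where `load` bounds it
      -- for each single arc.
      ≡⟨ ∑-comm (λ i x → ∑[ y < n ] (f x y * w i x y)) ⟩
    ∑[ x < n ] ∑[ i < m ] ∑[ y < n ] (f x y * w i x y)
      ≡⟨ sum-cong-≗ (λ x → ∑-comm (λ i y → f x y * w i x y)) ⟩
    ∑[ x < n ] ∑[ y < n ] ∑[ i < m ] (f x y * w i x y)
      ≤⟨ sum-mono-≤ (λ x → sum-mono-≤ (λ y → arc-bound x y)) ⟩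
    ∑[ x < n ] ∑[ y < n ] (k * f x y)
      ≡⟨ sum-cong-≗ (λ x → *-distribˡ-sum k (f x)) ⟨
    ∑[ x < n ] (k * ∑[ y < n ] f x y)
      ≡⟨ *-distribˡ-sum k (sum ∘ f) ⟨
    k * ∑[ x < n ] ∑[ y < n ] f x y
      ≡⟨ cong (k *_) (size≡sum F) ⟨
    k * size F ∎
    where
    open ≤-Reasoning
    f : Fin n → Fin n → ℕ
    f x y = 𝟙 (lookup (F x) y)
    w : Fin m → Fin n → Fin n → ℕ
    w = onCycle ∘ C
    arc-bound : ∀ x y → ∑[ i < m ] (f x y * w i x y) ≤ k * f x y
    arc-bound x y = begin
      ∑[ i < m ] (f x y * w i x y)  ≡⟨ *-distribˡ-sum (f x y) (λ i → w i x y) ⟨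
      f x y * (∑[ i < m ] w i x y)  ≤⟨ *-monoʳ-≤ (f x y) (load x y) ⟩
      f x y * k                     ≡⟨ *-comm (f x y) k ⟩
      k * f x y                     ∎

ascending⇒acyclic : {D : Digraph n} → (∀ u v → Arc D u v → u <ᶠ v) → Acyclic D
ascending⇒acyclic asc v vs c
  -- By transitivity `v` is below every later entry of the closed walk, and the last of these is `v`
  -- again.
  with v<vs ∷ _ ← Linked⇒AllPairs <ᶠ-trans (Linked.map (asc _ _) (DirectedCycle.arcs c))
  = <ᶠ-irrefl refl (proj₂ (∷ʳ⁻ v<vs))

-- Climb from `u` to the last vertex, take the closing arc to `zero`, and climb from there to `v`.
hamiltonian⇒strong : {D : Digraph (suc n)} → (∀ i → Arc D (inject₁ i) (suc i)) →
                     Arc D (fromℕ n) zero → StronglyConnected D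
hamiltonian⇒strong {n} {D} step last u v = to-last u ◅◅ last ◅ from-zero v
  where
  from-zero : ∀ v → Star (Arc D) zero v
  from-zero = <-weakInduction _ ε (λ i path → path ◅◅ step i ◅ ε)
  to-last : ∀ u → Star (Arc D) u (fromℕ n)
  to-last = >-weakInduction _ ε (λ i path → step i ◅ path)

directedCycle? : (D : Digraph n) (v : Fin n) (vs : List (Fin n)) → Dec (DirectedCycle D v vs)
directedCycle? D v vs = map′
  (λ (d , a) → record { distinct = d ; arcs = a })
  (λ c → DirectedCycle.distinct c , DirectedCycle.arcs c)
  (unique? _≟_ (v ∷ vs) ×-dec linked? (λ x y → y ∈? D x) (v ∷ (vs ∷ʳ v)))

-- The four deleted arcs together meet all seven vertices, so every degree drops from 6 to at most
-- 5. The Hamiltonian cycle through 0, 1, ..., 6 in order is untouched.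
D₇ : Digraph 7
D₇ = ⋃ ∘ map ⁅_⁆ ∘ lookup
  ( (1F ∷ 3F ∷ 5F ∷ [])
  ∷ (2F ∷ 4F ∷ 6F ∷ [])
  ∷ (3F ∷ 5F ∷ [])
  ∷ (4F ∷ 6F ∷ [])
  ∷ (5F ∷ 0F ∷ 2F ∷ [])
  ∷ (6F ∷ 1F ∷ [])
  ∷ (0F ∷ 2F ∷ [])
  ∷ [])

-- Each triangle is an ascending path closed by one backward arc: 4 → 0, 5 → 1, 6 → 0 and 6 → 2
-- close two triangles each, and 4 → 2 closes one.
triangles : Fin 9 → Fin 7 × List (Fin 7)
triangles = lookup
  ( (0F , 1F ∷ 4F ∷ [])
  ∷ (0F , 3F ∷ 4F ∷ [])
  ∷ (0F , 3F ∷ 6F ∷ [])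
  ∷ (0F , 5F ∷ 6F ∷ [])
  ∷ (1F , 2F ∷ 5F ∷ [])
  ∷ (1F , 4F ∷ 5F ∷ [])
  ∷ (2F , 3F ∷ 4F ∷ [])
  ∷ (2F , 3F ∷ 6F ∷ [])
  ∷ (2F , 5F ∷ 6F ∷ [])
  ∷ [])

backwardArcs : Digraph n → Digraph n
backwardArcs D u = D u ∩ tabulate (λ v → does (v <ᶠ? u))

oriented : Oriented D₇
oriented = record
  { loopless  = from-yes (all? λ v → ¬? (v ∈? D₇ v))
  ; no2Cycles = from-yes (all? λ u → all? λ v → v ∈? D₇ u →-dec ¬? (u ∈? D₇ v))
  }

stronglyConnected : StronglyConnected D₇
stronglyConnected =
  hamiltonian⇒strong (from-yes (all? λ i → suc i ∈? D₇ (inject₁ i))) (from-yes (0F ∈? D₇ 6F))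

backwardArcs-fas : FeedbackArcSet D₇ (backwardArcs D₇)
backwardArcs-fas = record
  { subset  = λ u → p∩q⊆p (D₇ u) _
  ; acyclic = ascending⇒acyclic
      (from-yes (all? λ u → all? λ v → v ∈? (D₇ -ᵃ backwardArcs D₇) u →-dec u <ᶠ? v))
  }

fas≥5 : ∀ F → FeedbackArcSet D₇ F → 5 ≤ size F
-- The packing bound `9 ≤ 2 * size F` unfolds to `2 * 4 < 2 * size F`; cancelling the 2 performs the
-- rounding up of 9/2 to 5.
fas≥5 F fas = *-cancelˡ-< 2 4 (size F) (packing-bound triangles 2
  (from-yes (all? λ i → uncurry (directedCycle? D₇) (triangles i)))
  (from-yes (all? λ x → all? λ y → ∑[ i < 9 ] onCycle (triangles i) x y ≤? 2))
  (FeedbackArcSet.acyclic fas))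

corollary10 : Σ[ n ∈ ℕ ] Σ[ D ∈ Digraph n ]
    (Oriented D × StronglyConnected D × Δ D ≤ 5 ×
    ∃[ k ] (IsFas D k × 2 * n < 3 * k))
corollary10 =
  7 , D₇ , oriented , stronglyConnected , from-yes (Δ D₇ ≤? 5) , 5 ,
  -- Here `refl` evaluates the number of backward arcs, which are 4 → 0, 4 → 2, 5 → 1, 6 → 0 and 6 →
  -- 2.
  record { attained = backwardArcs D₇ , backwardArcs-fas , refl ; minimal = fas≥5 } ,
  from-yes (14 <? 15)
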